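{- Let $\ell\ge 2$, let $p\in S_\ell$ be a permutation pattern, and let $k=\ell-2$. If $p$ is a Baxter permutation, then $s_n^k(p)=\binom{n}{k}$ for each $n\ge k$. If $p$ is not a Baxter permutation, then $s_n^k(p)<\binom{n}{k}$ for each $n\ge k+3$. Moreover, all Baxter permutations of length $\ell$ are strongly $k$-Wilf-equivalent.
   Context: A permutation $p\in S_\ell$ is a Baxter permutation if there are no indices $a<b<c<d$ in $[\ell]$ with $c=b+1$ such that $p_a,p_b,p_c,p_d$ is order-isomorphic to $2413$ or to $3142$. $S_n^k$ is the set of partial permutations of length $n$ with $k$ holes: sequences $\pi_1\cdots\pi_n$ in which each of $1,\dots,n-k$ appears exactly once and the remaining $k$ entries are a hole symbol $\diamond$; $S_n^H$ ($H\subseteq[n]$) consists of those whose holes are exactly at positions in $H$. A permutation $\sigma$ of $[n]$ is an extension of $\pi$ if the standardization (order-preserving relabeling by $1,2,\dots$) of the restriction of $\sigma$ to the non-hole positions of $\pi$ equals the restriction of $\pi$ to those positions. $\pi$ avoids a pattern $p$ if every extension of $\pi$ avoids $p$ (in the classical sense). $s_n^k(p)$ (resp. $s_n^H(p)$) is the number of $p$-avoiding elements of $S_n^k$ (resp. $S_n^H$). Patterns $p,q$ are strongly $k$-Wilf-equivalent if $s_n^H(p)=s_n^H(q)$ for every $n$ and every $k$-element $H\subseteq[n]$. -}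

module Defs where

open import Data.Nat as ℕ using (ℕ; _∸_)
open import Data.Fin as F using (Fin; toℕ)
open import Data.Fin.Permutation using (Permutation′; _⟨$⟩ʳ_)
open import Data.Fin.Subset using (Subset; _∈_)
open import Data.Maybe using (Maybe; just; nothing)
open import Data.Vec using (Vec; lookup; _∷_; [])
open import Data.Product using (Σ; ∃; _×_; _,_)
open import Function.Bundles using (_⇔_)
open import Relation.Binary.PropositionalEquality using (_≡_)
open import Relation.Nullary using (¬_)

-- A permutation of [n] is an element of Permutation′ n (a bijection Fin n ↔ Fin n);
-- position i (0-based) carries the value σ ⟨$⟩ʳ i.

OrderIso : ∀ {m} → Vec ℕ m → Vec ℕ m → Set
OrderIso {m} x y = ∀ (i j : Fin m) → (lookup x i ℕ.< lookup x j) ⇔ (lookup y i ℕ.< lookup y j)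

IsBaxter : ∀ {ℓ} → Permutation′ ℓ → Set
IsBaxter {ℓ} p =
  ∀ (a b c d : Fin ℓ) → a F.< b → b F.< c → c F.< d → toℕ c ≡ ℕ.suc (toℕ b) →
    let w = toℕ (p ⟨$⟩ʳ a) ∷ toℕ (p ⟨$⟩ʳ b) ∷ toℕ (p ⟨$⟩ʳ c) ∷ toℕ (p ⟨$⟩ʳ d) ∷ [] in
    ¬ OrderIso w (2 ∷ 4 ∷ 1 ∷ 3 ∷ []) × ¬ OrderIso w (3 ∷ 1 ∷ 4 ∷ 2 ∷ [])

Contains : ∀ {n ℓ} → Permutation′ n → Permutation′ ℓ → Set
Contains {n} {ℓ} σ p =
  Σ (Fin ℓ → Fin n) λ c →
    (∀ i j → i F.< j → c i F.< c j) ×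
    (∀ i j → (σ ⟨$⟩ʳ c i F.< σ ⟨$⟩ʳ c j) ⇔ (p ⟨$⟩ʳ i F.< p ⟨$⟩ʳ j))

AvoidsPerm : ∀ {n ℓ} → Permutation′ n → Permutation′ ℓ → Set
AvoidsPerm σ p = ¬ Contains σ p

-- Partial permutations of length n with k holes: a vector over Maybe (Fin (n ∸ k))
-- (nothing = hole ◇, just j = value j+1), with k ≤ n and every value
-- 0,…,n-k-1 occurring exactly once (hence exactly k holes).
IsPartialPerm : (n k : ℕ) → Vec (Maybe (Fin (n ∸ k))) n → Set
IsPartialPerm n k π =
  k ℕ.≤ n ×
  (∀ (j : Fin (n ∸ k)) → Σ (Fin n) λ i → lookup π i ≡ just j × (∀ i' → lookup π i' ≡ just j → i' ≡ i))

HolesAt : ∀ {n m} → Subset n → Vec (Maybe (Fin m)) n → Set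
HolesAt {n} H π = ∀ (i : Fin n) → (lookup π i ≡ nothing) ⇔ (i ∈ H)

-- σ is an extension of π: the restriction of σ to the non-hole positions of π,
-- standardized, equals the restriction of π; since the latter is a permutation of
-- 1..n-k, this says exactly that the two restrictions are order-isomorphic.
IsExtension : ∀ {n m} → Permutation′ n → Vec (Maybe (Fin m)) n → Set
IsExtension {n} σ π =
  ∀ (i j : Fin n) a b → lookup π i ≡ just a → lookup π j ≡ just b →
    (a F.< b) ⇔ (σ ⟨$⟩ʳ i F.< σ ⟨$⟩ʳ j)

Avoids : ∀ {n m ℓ} → Vec (Maybe (Fin m)) n → Permutation′ ℓ → Set
Avoids {n} π p = ∀ (σ : Permutation′ n) → IsExtension σ π → AvoidsPerm σ p

-- The set {x : A | P x} has exactly m elements (A has decidable ≡ in our uses,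
-- elements are compared by ≡ on A, not on proofs of P).
HasCard : {A : Set} → (A → Set) → ℕ → Set
HasCard {A} P m =
  Σ (Fin m → A) λ f →
    (∀ i → P (f i)) × (∀ i j → f i ≡ f j → i ≡ j) × (∀ x → P x → ∃ λ i → f i ≡ x)

s[_,_]≡ : (n k : ℕ) → ∀ {ℓ} → Permutation′ ℓ → ℕ → Set
s[ n , k ]≡ p m = HasCard (λ π → IsPartialPerm n k π × Avoids π p) m

sH[_,_,_]≡ : (n k : ℕ) → Subset n → ∀ {ℓ} → Permutation′ ℓ → ℕ → Set
sH[ n , k , H ]≡ p m = HasCard (λ π → IsPartialPerm n k π × HolesAt H π × Avoids π p) m

StronglyWilfEquiv : (k : ℕ) → ∀ {ℓ} → Permutation′ ℓ → Permutation′ ℓ → Set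
StronglyWilfEquiv k p q =
  ∀ (n : ℕ) (H : Subset n) → Data.Fin.Subset.∣ H ∣ ≡ k →
    ∃ λ m → sH[ n , k , H ]≡ p m × sH[ n , k , H ]≡ q m

{-# OPTIONS --safe #-}
-- Holes are wildcards, so an occurrence of p can always be shifted to use all k = ℓ − 2 holes
-- and exactly two entries. Hence π avoids p iff for any two entries at positions x < y, having
-- the indices i < j in H ∪ {x, y}, π_x < π_y holds exactly when p_i > p_j. A hole set H
-- thus prescribes a tournament on the non-holes: it carries exactly one avoider if the tournament
-- is transitive, and none otherwise. Since i depends only on the number of holes before x, and j is
-- one more than the number of holes before y, a cyclic triple x < y < z is an occurrence of 2413
-- or 3142 in p whose middle two positions are adjacent. Conversely every such occurrence is produced
-- by some H as soon as there is room for three non-holes.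
module Submission where

open import Defs
open import Data.Bool using (T)
open import Data.Fin as F using (Fin; zero; suc; toℕ; inject₁; fromℕ<)
open import Data.Fin.Induction using (<-weakInduction)
open import Data.Fin.Patterns using (0F; 1F; 2F; 3F)
open import Data.Fin.Permutation using (Permutation′; _⟨$⟩ʳ_; _⟨$⟩ˡ_; inverseʳ; permutation)
import Data.Fin.Properties as Fₚ
open import Data.Fin.Subset using (Subset; _∈_; _∉_; ∁; ⊥; ∣_∣; inside; outside)
import Data.Fin.Subset.Properties as Sₚ
open import Data.List as List using (List; length; filter; _++_)
open import Data.List.Membership.Propositional using () renaming (_∈_ to _∈ₗ_)
open import Data.List.Membership.Propositional.Properties
  using (∈-lookup; ∈-map⁺; ∈-map⁻; ∈-++⁺ˡ; ∈-++⁺ʳ; ∈-++⁻; ∈-filter⁺; ∈-filter⁻)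
import Data.List.Properties as Listₚ
open import Data.List.Relation.Unary.All as All using (All)
open import Data.List.Relation.Unary.All.Properties using (¬All⇒Any¬)
open import Data.List.Relation.Unary.AllPairs using ([]; _∷_)
open import Data.List.Relation.Unary.Any as Any using (here; there)
open import Data.List.Relation.Unary.Any.Properties using (lookup-index)
open import Data.List.Relation.Unary.Unique.Propositional using (Unique)
import Data.List.Relation.Unary.Unique.Propositional.Properties as Uniqueₚ
open import Data.Maybe using (Maybe; just; nothing; is-nothing)
open import Data.Maybe.Properties using (just-injective)
open import Data.Nat as ℕ using (ℕ; zero; suc; _∸_; _+_; _*_; _≤_; _<_; s≤s; z≤n)
open import Data.Nat.Combinatorics using (_C_; nCk+nC[k+1]≡[n+1]C[k+1]; nCk≡nC[n∸k]; nCn≡1)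
import Data.Nat.Properties as ℕₚ
open import Data.Product using (Σ; ∃; _×_; _,_; proj₁; proj₂; map₂)
open import Data.Sum using (_⊎_; inj₁; inj₂; [_,_]′)
open import Data.Vec using (Vec; []; _∷_; here; there; lookup; map; tabulate; _[_]≔_)
open import Data.Vec.Properties
  using ([]=⇒lookup; lookup⇒[]=; lookup-map; lookup∘tabulate; tabulate∘lookup; tabulate-cong; ∷-injectiveʳ)
open import Function using (_∘_; flip; id)
open import Function.Bundles using (_⇔_; mk⇔; Equivalence; Injection)
open import Function.Definitions using (Injective)
open import Function.Properties.Inverse using (↔⇒↣)
open import Relation.Binary using (Tri; tri<; tri≈; tri>)
open import Relation.Binary.PropositionalEquality
  using (_≡_; _≢_; refl; sym; trans; cong; cong₂; subst; subst₂; module ≡-Reasoning)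
open import Relation.Nullary using (¬_; Dec; yes; no; does; contradiction; from-yes)
open import Relation.Nullary.Decidable using (dec-true; ¬?; _→-dec_; _×-dec_; _⊎-dec_)
open import Relation.Unary using (Decidable)

-- Permutations from linear orders

injective⇒surjective : ∀ {n} (f : Fin n → Fin n) → Injective _≡_ _≡_ f → ∀ y → ∃ λ x → f x ≡ y
injective⇒surjective {suc n} f f-inj y with Fₚ.any? (λ x → f x Fₚ.≟ y)
... | yes hit = hit
-- Deleting the missed value `y` from the codomain would leave an injection from `Fin (suc n)` into
-- `Fin n`.
... | no miss = contradiction
  (Fₚ.injective⇒≤ (λ eq → f-inj (Fₚ.punchOut-injective (missed _) (missed _) eq))) ℕₚ.1+n≰n
  where
  missed : ∀ x → y ≢ f x
  missed x eq = miss (x , sym eq)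

subsetOf : ∀ {n} {P : Fin n → Set} → Decidable P → Subset n
subsetOf P? = tabulate (does ∘ P?)

∈-subsetOf⁺ : ∀ {n} {P : Fin n → Set} (P? : Decidable P) {x} → P x → x ∈ subsetOf P?
∈-subsetOf⁺ P? {x} px =
  lookup⇒[]= x _ (trans (lookup∘tabulate (does ∘ P?) x) (dec-true (P? x) px))

∈-subsetOf⁻ : ∀ {n} {P : Fin n → Set} (P? : Decidable P) {x} → x ∈ subsetOf P? → P x
∈-subsetOf⁻ P? {x} x∈ with P? x | trans (sym (lookup∘tabulate (does ∘ P?) x)) ([]=⇒lookup x∈)
... | yes px | _ = px
... | no _ | ()

module _ {n : ℕ} (R : Fin n → Fin n → Set) (R? : ∀ i j → Dec (R i j))
         (irrefl : ∀ i → ¬ R i i) (R-trans : ∀ i j k → R i j → R j k → R i k)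
         (connex : ∀ i j → i ≢ j → R i j ⊎ R j i) where

  private
    lower : Fin n → Subset n
    lower i = subsetOf (λ j → R? j i)

    score : Fin n → Fin n
    score i = F.fromℕ< (subst (∣ lower i ∣ <_) (Sₚ.∣⊤∣≡n n)
      (Sₚ.p⊂q⇒∣p∣<∣q∣ (Sₚ.⊆⊤ , i , Sₚ.∈⊤ , irrefl i ∘ ∈-subsetOf⁻ (λ j → R? j i))))

    score-mono : ∀ i j → R i j → score i F.< score j
    score-mono i j r = subst₂ _<_ (sym (Fₚ.toℕ-fromℕ< _)) (sym (Fₚ.toℕ-fromℕ< _))
      (Sₚ.p⊂q⇒∣p∣<∣q∣
        ( (λ x∈ → ∈-subsetOf⁺ (λ k → R? k j) (R-trans _ i j (∈-subsetOf⁻ (λ k → R? k i) x∈) r))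
        , i , ∈-subsetOf⁺ (λ k → R? k j) r , irrefl i ∘ ∈-subsetOf⁻ (λ k → R? k i)))

    score-inj : Injective _≡_ _≡_ score
    score-inj {i} {j} eq with i Fₚ.≟ j
    ... | yes i≡j = i≡j
    ... | no i≢j with connex i j i≢j
    ... | inj₁ r = contradiction eq (Fₚ.<⇒≢ (score-mono i j r))
    ... | inj₂ r = contradiction (sym eq) (Fₚ.<⇒≢ (score-mono j i r))

    unscore : ∀ y → ∃ λ x → score x ≡ y
    unscore = injective⇒surjective score score-inj

  -- The rank of `i` is its number of predecessors. Transitivity and irreflexivity make it strictly
  -- increasing along `R`, connexity then makes it injective, and finiteness makes it bijective.
  linearOrder⇒permutation : Σ (Permutation′ n) λ σ → ∀ i j → R i j → σ ⟨$⟩ʳ i F.< σ ⟨$⟩ʳ j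
  linearOrder⇒permutation =
    permutation score (proj₁ ∘ unscore) (proj₂ ∘ unscore)
      (λ x → score-inj (proj₂ (unscore (score x))))
    , score-mono

-- One more in `t` contributes a whole `L`, more than `o` can make up. So `L * t + o` codes pairs
-- lexicographically as long as `o < L`; both sort keys below rely on this.
pair-mono-< : ∀ L {t t′ o o′} → o < L → t < t′ → L * t + o < L * t′ + o′
pair-mono-< L {t} {t′} {o} {o′} o<L t<t′ = begin-strict
  L * t + o    <⟨ ℕₚ.+-monoʳ-< (L * t) o<L ⟩
  L * t + L    ≡⟨ ℕₚ.+-comm (L * t) L ⟩
  L + L * t    ≡⟨ ℕₚ.*-suc L t ⟨
  L * suc t    ≤⟨ ℕₚ.*-monoʳ-≤ L t<t′ ⟩
  L * t′       ≤⟨ ℕₚ.m≤m+n (L * t′) o′ ⟩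
  L * t′ + o′  ∎
  where open ℕₚ.≤-Reasoning

-- Ties between equal keys are broken by position.
key⇒permutation : ∀ {n} (key : Fin n → ℕ) →
  Σ (Permutation′ n) λ σ → ∀ i j → key i < key j → σ ⟨$⟩ʳ i F.< σ ⟨$⟩ʳ j
key⇒permutation {n} key = proj₁ perm , λ i j lt → proj₂ perm i j (pair-mono-< n (Fₚ.toℕ<n i) lt)
  where
  code : Fin n → ℕ
  code i = n * key i + toℕ i

  connex : ∀ i j → i ≢ j → code i < code j ⊎ code j < code i
  connex i j i≢j with ℕₚ.<-cmp (key i) (key j)
  ... | tri< lt _ _ = inj₁ (pair-mono-< n (Fₚ.toℕ<n i) lt)
  ... | tri> _ _ gt = inj₂ (pair-mono-< n (Fₚ.toℕ<n j) gt)
  ... | tri≈ _ eq _ with Fₚ.<-cmp i j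
  ...   | tri< lt _ _ = inj₁ (subst (λ v → n * v + toℕ i < code j) (sym eq) (ℕₚ.+-monoʳ-< (n * key j) lt))
  ...   | tri> _ _ gt = inj₂ (subst (λ v → code j < n * v + toℕ i) (sym eq) (ℕₚ.+-monoʳ-< (n * key j) gt))
  ...   | tri≈ _ i≡j _ = contradiction i≡j i≢j

  perm = linearOrder⇒permutation (λ i j → code i < code j) (λ i j → code i ℕ.<? code j)
    (λ i → ℕₚ.<-irrefl refl) (λ i j k → ℕₚ.<-trans) connex

⟨$⟩ʳ-injective : ∀ {n} (σ : Permutation′ n) {i j} → σ ⟨$⟩ʳ i ≡ σ ⟨$⟩ʳ j → i ≡ j
⟨$⟩ʳ-injective σ = Injection.injective (↔⇒↣ σ)

-- Extensions with a prescribed occurrence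

ExactlyOnce : ∀ {n m} → Vec (Maybe (Fin m)) n → Set
ExactlyOnce {n} {m} π =
  ∀ (j : Fin m) → Σ (Fin n) λ i → lookup π i ≡ just j × (∀ i′ → lookup π i′ ≡ just j → i′ ≡ i)

position-unique : ∀ {n m} {π : Vec (Maybe (Fin m)) n} → ExactlyOnce π →
  ∀ {i j a b} → lookup π i ≡ just a → lookup π j ≡ just b → a ≡ b → i ≡ j
position-unique once {a = a} πi πj refl =
  trans (proj₂ (proj₂ (once a)) _ πi) (sym (proj₂ (proj₂ (once a)) _ πj))

-- Trichotomy supplies the converse direction: given `a′ < b′`, the alternatives to `a < b` are
-- refuted by `eq` and `down`.
<-⇔ : ∀ {m n} {a b : Fin m} {a′ b′ : Fin n} →
  (a F.< b → a′ F.< b′) → (b F.< a → b′ F.< a′) → (a ≡ b → a′ ≡ b′) → (a F.< b) ⇔ (a′ F.< b′)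
<-⇔ {a = a} {b} {a′} {b′} up down eq = mk⇔ up back
  where
  back : a′ F.< b′ → a F.< b
  back lt with Fₚ.<-cmp a b
  ... | tri< a<b _ _ = a<b
  ... | tri≈ _ a≡b _ = contradiction (eq a≡b) (Fₚ.<⇒≢ lt)
  ... | tri> _ _ b<a = contradiction (down b<a) (Fₚ.<-asym lt)

strictMono-injective : ∀ {m n} {f : Fin m → Fin n} → (∀ i j → i F.< j → f i F.< f j) →
  ∀ {i j} → f i ≡ f j → i ≡ j
strictMono-injective mono {i} {j} eq with Fₚ.<-cmp i j
... | tri< i<j _ _ = contradiction eq (Fₚ.<⇒≢ (mono i j i<j))
... | tri≈ _ i≡j _ = i≡j
... | tri> _ _ j<i = contradiction (sym eq) (Fₚ.<⇒≢ (mono j i j<i))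

step : ℕ → ℕ → ℕ → ℕ
step θ h q with θ ℕ.≤? q
... | yes _ = h
... | no _ = 0

step-mono : ∀ θ h {q r} → q ≤ r → step θ h q ≤ step θ h r
step-mono θ h {q} {r} q≤r with θ ℕ.≤? q | θ ℕ.≤? r
... | no _ | _ = z≤n
... | yes _ | yes _ = ℕₚ.≤-refl
... | yes θ≤q | no θ≰r = contradiction (ℕₚ.≤-trans θ≤q q≤r) θ≰r

step-≤ : ∀ {θ h q} → θ ≤ q → step θ h q ≡ h
step-≤ {θ} {h} {q} θ≤q with θ ℕ.≤? q
... | yes _ = refl
... | no θ≰q = contradiction θ≤q θ≰q

step-> : ∀ {θ h q} → q < θ → step θ h q ≡ 0
step-> {θ} {h} {q} q<θ with θ ℕ.≤? q
... | yes θ≤q = contradiction q<θ (ℕₚ.≤⇒≯ θ≤q)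
... | no _ = refl

module _ {n m ℓ : ℕ} (π : Vec (Maybe (Fin m)) n) (p : Permutation′ ℓ) (c : Fin ℓ → Fin n)
         (c-mono : ∀ i j → i F.< j → c i F.< c j) (once : ExactlyOnce π)
         (s t : Fin ℓ) (u w : Fin m) (πs : lookup π (c s) ≡ just u) (πt : lookup π (c t) ≡ just w)
         (u<w : u F.< w) (ps<pt : p ⟨$⟩ʳ s F.< p ⟨$⟩ʳ t)
         (others : ∀ r → r ≢ s → r ≢ t → lookup π (c r) ≡ nothing) where

  private
    -- The entry π_z = v lies in tier v + 1. The pattern value q is put in the tier of the
    -- largest of the two prescribed values that it must not be below.
    tier : ℕ → ℕ
    tier q = step (toℕ (p ⟨$⟩ʳ s)) (suc (toℕ u)) q ℕ.⊔ step (toℕ (p ⟨$⟩ʳ t)) (suc (toℕ w)) q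

    tier-mono : ∀ {q r} → q ≤ r → tier q ≤ tier r
    tier-mono q≤r = ℕₚ.⊔-mono-≤
      (step-mono (toℕ (p ⟨$⟩ʳ s)) (suc (toℕ u)) q≤r) (step-mono (toℕ (p ⟨$⟩ʳ t)) (suc (toℕ w)) q≤r)

    tier-s : tier (toℕ (p ⟨$⟩ʳ s)) ≡ suc (toℕ u)
    tier-s rewrite step-≤ {_} {suc (toℕ u)} (ℕₚ.≤-refl {toℕ (p ⟨$⟩ʳ s)})
                 | step-> {_} {suc (toℕ w)} ps<pt = refl

    tier-t : tier (toℕ (p ⟨$⟩ʳ t)) ≡ suc (toℕ w)
    tier-t rewrite step-≤ {_} {suc (toℕ w)} (ℕₚ.≤-refl {toℕ (p ⟨$⟩ʳ t)})
                 | step-≤ {_} {suc (toℕ u)} (ℕₚ.<⇒≤ ps<pt) = cong suc (ℕₚ.m≤n⇒m⊔n≡n (ℕₚ.<⇒≤ u<w))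

    entryTier : Maybe (Fin m) → ℕ
    entryTier (just v) = suc (toℕ v)
    -- Holes outside the occurrence are unconstrained; they go to the bottom tier, which no entry
    -- uses.
    entryTier nothing = 0

    key : Fin n → ℕ
    key z with Fₚ.any? (λ r → c r Fₚ.≟ z)
    ... | yes (r , _) = ℓ * tier (toℕ (p ⟨$⟩ʳ r)) + toℕ (p ⟨$⟩ʳ r)
    ... | no _ = ℓ * entryTier (lookup π z) + 0

    key-c : ∀ r → key (c r) ≡ ℓ * tier (toℕ (p ⟨$⟩ʳ r)) + toℕ (p ⟨$⟩ʳ r)
    key-c r with Fₚ.any? (λ r′ → c r′ Fₚ.≟ c r)
    ... | no miss = contradiction (r , refl) miss
    ... | yes (r′ , eq) with refl ← strictMono-injective c-mono eq = refl

    -- The leading digit of an entry's key is its own tier even inside the occurrence: the only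
    -- entries there sit at `c s` and `c t`, where `tier-s` and `tier-t` make the two definitions
    -- agree.
    key-entry : ∀ {z v} → lookup π z ≡ just v → ∃ λ o → o < ℓ × key z ≡ ℓ * suc (toℕ v) + o
    key-entry {z} {v} πz with Fₚ.any? (λ r → c r Fₚ.≟ z)
    ... | no _ rewrite πz = 0 , ℕₚ.≤-<-trans z≤n (Fₚ.toℕ<n s) , refl
    ... | yes (r , refl) with r Fₚ.≟ s | r Fₚ.≟ t
    ...   | yes refl | _ with refl ← just-injective (trans (sym πs) πz) =
              _ , Fₚ.toℕ<n (p ⟨$⟩ʳ r) , cong (λ x → ℓ * x + _) tier-s
    ...   | no _ | yes refl with refl ← just-injective (trans (sym πt) πz) =
              _ , Fₚ.toℕ<n (p ⟨$⟩ʳ r) , cong (λ x → ℓ * x + _) tier-t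
    ...   | no r≢s | no r≢t with () ← trans (sym πz) (others r r≢s r≢t)

    σ : Permutation′ n
    σ = proj₁ (key⇒permutation key)

    σ-mono : ∀ i j → key i < key j → σ ⟨$⟩ʳ i F.< σ ⟨$⟩ʳ j
    σ-mono = proj₂ (key⇒permutation key)

    σ-entry : ∀ {i j a b} → lookup π i ≡ just a → lookup π j ≡ just b → a F.< b → σ ⟨$⟩ʳ i F.< σ ⟨$⟩ʳ j
    σ-entry {i} {j} πi πj a<b with key-entry πi | key-entry πj
    ... | o , o<ℓ , ki | o′ , _ , kj =
      σ-mono i j (subst₂ _<_ (sym ki) (sym kj) (pair-mono-< ℓ o<ℓ (s≤s a<b)))

    σ-c : ∀ i j → p ⟨$⟩ʳ i F.< p ⟨$⟩ʳ j → σ ⟨$⟩ʳ c i F.< σ ⟨$⟩ʳ c j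
    σ-c i j lt = σ-mono (c i) (c j) (subst₂ _<_ (sym (key-c i)) (sym (key-c j))
      (ℕₚ.+-mono-≤-< (ℕₚ.*-monoʳ-≤ ℓ (tier-mono (ℕₚ.<⇒≤ lt))) lt))

  -- Sorting by `key` gives an extension in which `c` is an occurrence of `p`: distinct entries
  -- differ in the leading digit, and along `c` a larger pattern value never lowers the leading
  -- digit and raises the trailing one.
  realize : ¬ Avoids π p
  realize avoids = avoids σ
    (λ i j a b πi πj → <-⇔ (σ-entry πi πj) (σ-entry πj πi)
      (λ a≡b → cong (σ ⟨$⟩ʳ_) (position-unique {π = π} once πi πj a≡b)))
    (c , c-mono , λ i j → mk⇔
      (Equivalence.from (<-⇔ (σ-c i j) (σ-c j i) (λ eq → cong ((σ ⟨$⟩ʳ_) ∘ c) (⟨$⟩ʳ-injective p eq))))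
      (σ-c i j))

-- Positions relative to a hole set

-- Counts the elements of `S` smaller than `v`. The bound is a plain natural number because
-- `crossing` also evaluates it one past a position, possibly at `n`.
below : ∀ {n} → Subset n → ℕ → ℕ
below [] _ = 0
below (_ ∷ _) zero = 0
below (inside ∷ S) (suc v) = suc (below S v)
below (outside ∷ S) (suc v) = below S v

below-mono : ∀ {n} (S : Subset n) {v w} → v ≤ w → below S v ≤ below S w
below-mono [] _ = z≤n
below-mono (_ ∷ _) {zero} _ = z≤n
below-mono (inside ∷ S) (s≤s v≤w) = s≤s (below-mono S v≤w)
below-mono (outside ∷ S) (s≤s v≤w) = below-mono S v≤w

below≤∣∣ : ∀ {n} (S : Subset n) v → below S v ≤ ∣ S ∣
below≤∣∣ [] _ = z≤n
below≤∣∣ (_ ∷ _) zero = z≤n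
below≤∣∣ (inside ∷ S) (suc v) = s≤s (below≤∣∣ S v)
below≤∣∣ (outside ∷ S) (suc v) = below≤∣∣ S v

below-suc-∈ : ∀ {n} {S : Subset n} {x} → x ∈ S → below S (suc (toℕ x)) ≡ suc (below S (toℕ x))
below-suc-∈ {S = inside ∷ S} here with S
... | [] = refl
... | _ ∷ _ = refl
below-suc-∈ {S = inside ∷ S} (there x∈S) = cong suc (below-suc-∈ x∈S)
below-suc-∈ {S = outside ∷ S} (there x∈S) = below-suc-∈ x∈S

-- The excess below S (c i) + t − i can only decrease at an i with c i ∉ S, and then by at
-- most 1, so it vanishes at such an i before it becomes negative. The induction is on
-- the suffixes of a sequence, s being the number of entries already removed.
crossing : ∀ {n L} (S : Subset n) (c : Fin L → Fin n) (s t v : ℕ) → (∀ i j → i F.< j → c i F.< c j) →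
  (∀ i → v ≤ toℕ (c i)) → s ≤ below S v + t → ∣ S ∣ + t < s + L →
  Σ (Fin L) λ i → c i ∉ S × s + toℕ i ≡ below S (toℕ (c i)) + t ×
    (∀ j → j F.< i → s + toℕ j ≤ below S (toℕ (c j)) + t)
-- An exhausted sequence would have an excess that is nonnegative by `start` and negative by `end`.
crossing {L = zero} S c s t v mono v≤c start end = contradiction
  (ℕₚ.≤-trans (subst (_ ≤_) (ℕₚ.+-identityʳ s) end) (ℕₚ.≤-trans start (ℕₚ.+-monoˡ-≤ t (below≤∣∣ S v))))
  ℕₚ.1+n≰n
crossing {n} {suc L} S c s t v mono v≤c start end = split (c zero Sₚ.∈? S) (s ℕ.≟ below S (toℕ (c zero)) + t)
  where
  Result = Σ (Fin (suc L)) λ i → c i ∉ S × s + toℕ i ≡ below S (toℕ (c i)) + t ×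
    (∀ j → j F.< i → s + toℕ j ≤ below S (toℕ (c j)) + t)

  start₀ : s ≤ below S (toℕ (c zero)) + t
  start₀ = ℕₚ.≤-trans start (ℕₚ.+-monoˡ-≤ t (below-mono S (v≤c zero)))

  next : suc s ≤ below S (suc (toℕ (c zero))) + t → Result
  next start′ with crossing S (c ∘ suc) (suc s) t (suc (toℕ (c zero)))
                    (λ i j lt → mono (suc i) (suc j) (s≤s lt)) (λ i → mono zero (suc i) (s≤s z≤n))
                    start′ (subst (∣ S ∣ + t <_) (ℕₚ.+-suc s L) end)
  ... | i , ci∉S , eq , before = suc i , ci∉S , trans (ℕₚ.+-suc s (toℕ i)) eq , λ where
    zero _ → subst (_≤ below S (toℕ (c zero)) + t) (sym (ℕₚ.+-identityʳ s)) start₀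
    (suc j) (s≤s j<i) → subst (_≤ below S (toℕ (c (suc j))) + t) (sym (ℕₚ.+-suc s (toℕ j))) (before j j<i)

  split : Dec (c zero ∈ S) → Dec (s ≡ below S (toℕ (c zero)) + t) → Result
  split (yes c₀∈S) _ = next (subst (λ b → suc s ≤ b + t) (sym (below-suc-∈ c₀∈S)) (s≤s start₀))
  split (no c₀∉S) (yes eq) = zero , c₀∉S , trans (ℕₚ.+-identityʳ s) eq , λ _ ()
  split (no _) (no s≢) = next (ℕₚ.≤-trans (ℕₚ.≤∧≢⇒< start₀ s≢)
    (ℕₚ.+-monoˡ-≤ t (below-mono S (ℕₚ.n≤1+n (toℕ (c zero))))))

-- Two terms more than `S` has elements suffice for a crossing with offset 0, at `i`, and one with
-- offset 1, at `j`. With offset 0 the excess at `j` is -1, but before `i` it is nonnegative, so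
-- `i < j`. In an occurrence of a pattern this finds two entries whose pattern indices depend only
-- on their positions.
two-crossings : ∀ {n k} (S : Subset n) → ∣ S ∣ ≡ k → (c : Fin (2 + k) → Fin n) →
  (∀ i j → i F.< j → c i F.< c j) →
  Σ (Fin (2 + k)) λ i → Σ (Fin (2 + k)) λ j → i F.< j × c i ∉ S × c j ∉ S ×
    toℕ i ≡ below S (toℕ (c i)) × toℕ j ≡ suc (below S (toℕ (c j)))
two-crossings S refl c mono
  with i , i∉ , i≡ , before ← crossing S c 0 0 0 mono (λ _ → z≤n) z≤n
         (subst (_< 2 + ∣ S ∣) (sym (ℕₚ.+-identityʳ ∣ S ∣)) (ℕₚ.m<n+m ∣ S ∣ {2} (s≤s z≤n)))
     | j , j∉ , j≡ , _ ← crossing S c 0 1 0 mono (λ _ → z≤n) z≤n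
         (subst (_< 2 + ∣ S ∣) (ℕₚ.+-comm 1 ∣ S ∣) ℕₚ.≤-refl)
  = i , j , i<j , i∉ , j∉ , i≡′ , j≡′
  where
  i≡′ = trans i≡ (ℕₚ.+-identityʳ _)
  j≡′ = trans j≡ (ℕₚ.+-comm _ 1)
  i<j : i F.< j
  i<j with Fₚ.<-cmp i j
  ... | tri< lt _ _ = lt
  ... | tri≈ _ refl _ = contradiction (trans (sym j≡′) i≡′) ℕₚ.1+n≢n
  ... | tri> _ _ j<i = contradiction (subst₂ _≤_ j≡′ (ℕₚ.+-identityʳ _) (before j j<i)) ℕₚ.1+n≰n

-- The size is a separate index with an equation, so that the domain can be `Fin (2 + k)` or `Fin m`
-- without transport.
enum : ∀ {n k} (S : Subset n) → ∣ S ∣ ≡ k → Fin k → Fin n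
enum (inside ∷ S) refl zero = zero
enum (inside ∷ S) refl (suc i) = suc (enum S refl i)
enum (outside ∷ S) refl i = suc (enum S refl i)

enum-mono : ∀ {n k} (S : Subset n) (eq : ∣ S ∣ ≡ k) i j → i F.< j → enum S eq i F.< enum S eq j
enum-mono (inside ∷ S) refl zero (suc j) _ = s≤s z≤n
enum-mono (inside ∷ S) refl (suc i) (suc j) (s≤s i<j) = s≤s (enum-mono S refl i j i<j)
enum-mono (outside ∷ S) refl i j i<j = s≤s (enum-mono S refl i j i<j)

enum-∈ : ∀ {n k} (S : Subset n) (eq : ∣ S ∣ ≡ k) i → enum S eq i ∈ S
enum-∈ (inside ∷ S) refl zero = here
enum-∈ (inside ∷ S) refl (suc i) = there (enum-∈ S refl i)
enum-∈ (outside ∷ S) refl i = there (enum-∈ S refl i)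

enum-surjective : ∀ {n k} {S : Subset n} (eq : ∣ S ∣ ≡ k) {x} → x ∈ S → ∃ λ i → enum S eq i ≡ x
enum-surjective {S = inside ∷ S} refl here = zero , refl
enum-surjective {S = inside ∷ S} refl (there x∈S) with i , refl ← enum-surjective refl x∈S = suc i , refl
enum-surjective {S = outside ∷ S} refl (there x∈S) with i , refl ← enum-surjective refl x∈S = i , refl

∣[]≔inside∣ : ∀ {n} {S : Subset n} {x} → x ∉ S → ∣ S [ x ]≔ inside ∣ ≡ suc ∣ S ∣
∣[]≔inside∣ {S = inside ∷ S} {zero} x∉S = contradiction here x∉S
∣[]≔inside∣ {S = outside ∷ S} {zero} x∉S = refl
∣[]≔inside∣ {S = inside ∷ S} {suc x} x∉S = cong suc (∣[]≔inside∣ (x∉S ∘ there))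
∣[]≔inside∣ {S = outside ∷ S} {suc x} x∉S = ∣[]≔inside∣ (x∉S ∘ there)

∈-[]≔inside⁻ : ∀ {n} {S : Subset n} {x z} → z ∈ S [ x ]≔ inside → z ≢ x → z ∈ S
∈-[]≔inside⁻ {S = _ ∷ _} {zero} here z≢x = contradiction refl z≢x
∈-[]≔inside⁻ {S = _ ∷ _} {zero} (there z∈) z≢x = there z∈
∈-[]≔inside⁻ {S = _ ∷ _} {suc x} here z≢x = here
∈-[]≔inside⁻ {S = _ ∷ _} {suc x} (there z∈) z≢x = there (∈-[]≔inside⁻ z∈ (z≢x ∘ cong suc))

-- The pattern indices of x and y in the increasing enumeration of H ∪ {x, y} are read off
-- from any such enumeration by two-crossings.
record Insertion {n k} (H : Subset n) (x y : Fin n) : Set where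
  field
    c : Fin (2 + k) → Fin n
    c-mono : ∀ i j → i F.< j → c i F.< c j
    s t : Fin (2 + k)
    cs : c s ≡ x
    ct : c t ≡ y
    s≡ : toℕ s ≡ below H (toℕ x)
    t≡ : toℕ t ≡ suc (below H (toℕ y))
    others : ∀ r → r ≢ s → r ≢ t → c r ∈ H

insertion : ∀ {n k} (H : Subset n) → ∣ H ∣ ≡ k → ∀ {x y} → x ∉ H → y ∉ H → x F.< y →
  Insertion {n} {k} H x y
insertion {n} {k} H ∣H∣ {x} {y} x∉H y∉H x<y = record
  { c = c ; c-mono = c-mono ; s = s ; t = t ; cs = proj₁ cs×ct ; ct = proj₂ cs×ct
  ; s≡ = trans s≡ (cong (below H ∘ toℕ) (proj₁ cs×ct))
  ; t≡ = trans t≡ (cong (suc ∘ below H ∘ toℕ) (proj₂ cs×ct))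
  ; others = λ r r≢s r≢t → new (c r) (enum-∈ H″ ∣H″∣ r)
      (λ eq → r≢s (strictMono-injective c-mono (trans eq (sym (proj₁ cs×ct)))))
      (λ eq → r≢t (strictMono-injective c-mono (trans eq (sym (proj₂ cs×ct)))))
  }
  where
  H′ = H [ x ]≔ inside
  H″ = H′ [ y ]≔ inside

  y∉H′ : y ∉ H′
  y∉H′ y∈ = y∉H (∈-[]≔inside⁻ y∈ (Fₚ.<⇒≢ x<y ∘ sym))

  ∣H″∣ : ∣ H″ ∣ ≡ 2 + k
  ∣H″∣ = trans (∣[]≔inside∣ y∉H′) (cong suc (trans (∣[]≔inside∣ x∉H) (cong suc ∣H∣)))

  new : ∀ z → z ∈ H″ → z ≢ x → z ≢ y → z ∈ H
  new z z∈ z≢x z≢y = ∈-[]≔inside⁻ (∈-[]≔inside⁻ z∈ z≢y) z≢x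

  c : Fin (2 + k) → Fin n
  c = enum H″ ∣H″∣

  c-mono : ∀ i j → i F.< j → c i F.< c j
  c-mono = enum-mono H″ ∣H″∣

  crossings = two-crossings H ∣H∣ c c-mono
  s = proj₁ crossings
  t = proj₁ (proj₂ crossings)
  s<t = proj₁ (proj₂ (proj₂ crossings))
  s∉ = proj₁ (proj₂ (proj₂ (proj₂ crossings)))
  t∉ = proj₁ (proj₂ (proj₂ (proj₂ (proj₂ crossings))))
  s≡ = proj₁ (proj₂ (proj₂ (proj₂ (proj₂ (proj₂ crossings)))))
  t≡ = proj₂ (proj₂ (proj₂ (proj₂ (proj₂ (proj₂ crossings)))))

  x-or-y : ∀ r → c r ∉ H → c r ≡ x ⊎ c r ≡ y
  x-or-y r cr∉H with c r Fₚ.≟ x | c r Fₚ.≟ y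
  ... | yes eq | _ = inj₁ eq
  ... | no _ | yes eq = inj₂ eq
  ... | no ≢x | no ≢y = contradiction (new (c r) (enum-∈ H″ ∣H″∣ r) ≢x ≢y) cr∉H

  -- `c s` and `c t` lie outside `H`, so each is `x` or `y`; `s < t` and `x < y` decide which is
  -- which.
  cs×ct : c s ≡ x × c t ≡ y
  cs×ct with x-or-y s s∉ | x-or-y t t∉
  ... | inj₁ sx | inj₂ ty = sx , ty
  ... | inj₁ sx | inj₁ tx = contradiction (trans sx (sym tx)) (Fₚ.<⇒≢ (c-mono s t s<t))
  ... | inj₂ sy | inj₂ ty = contradiction (trans sy (sym ty)) (Fₚ.<⇒≢ (c-mono s t s<t))
  ... | inj₂ sy | inj₁ tx = contradiction (subst₂ F._<_ sy tx (c-mono s t s<t)) (Fₚ.<-asym x<y)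

private variable
  n m k : ℕ
  H : Subset n
  π π′ : Vec (Maybe (Fin m)) n
  x y : Fin n

-- The tournament of a hole set

-- Truncation keeps `lo` and `hi` free of a size proof, so that `acyclic?` is defined on all subsets
-- and can be passed to `filter`.
clamp : ∀ k → ℕ → Fin (suc k)
clamp k v = fromℕ< (s≤s (ℕₚ.m⊓n≤n v k))

toℕ-clamp : ∀ {v} → v ≤ k → toℕ (clamp k v) ≡ v
toℕ-clamp v≤k = trans (Fₚ.toℕ-fromℕ< _) (ℕₚ.m≤n⇒m⊓n≡m v≤k)

-- For non-holes x < y, the pattern indices of x and of y within H ∪ {x, y}; clamping
-- has no effect if ∣ H ∣ ≡ k.
lo hi : ∀ {n} k → Subset n → Fin n → Fin (2 + k)
lo k H x = inject₁ (clamp k (below H (toℕ x)))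
hi k H y = suc (clamp k (below H (toℕ y)))

toℕ-lo : (H : Subset n) (x : Fin n) → ∣ H ∣ ≡ k → toℕ (lo k H x) ≡ below H (toℕ x)
toℕ-lo H x refl = trans (Fₚ.toℕ-inject₁ _) (toℕ-clamp (below≤∣∣ H (toℕ x)))

toℕ-hi : (H : Subset n) (y : Fin n) → ∣ H ∣ ≡ k → toℕ (hi k H y) ≡ suc (below H (toℕ y))
toℕ-hi H y refl = cong suc (toℕ-clamp (below≤∣∣ H (toℕ y)))

-- The inequality between positions is weak because `baxter⇒acyclic` compares the two indices `lo`
-- and `hi` of one and the same position.
lo<hi : (H : Subset n) → ∣ H ∣ ≡ k → x F.≤ y → lo k H x F.< hi k H y
lo<hi {x = x} {y} H ∣H∣ x≤y = subst₂ _<_ (sym (toℕ-lo H x ∣H∣)) (sym (toℕ-hi H y ∣H∣))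
  (s≤s (below-mono H x≤y))

-- The arcs of the tournament: an avoider orders two entries opposite to the pattern, so an
-- inversion of `p` at these indices forces an ascent from `x` to `y`.
Inverted : Permutation′ (2 + k) → Subset n → Fin n → Fin n → Set
Inverted {k} p H x y = p ⟨$⟩ʳ hi k H y F.< p ⟨$⟩ʳ lo k H x

inverted? : (p : Permutation′ (2 + k)) (H : Subset n) (x y : Fin n) → Dec (Inverted p H x y)
inverted? {k} p H x y = p ⟨$⟩ʳ hi k H y Fₚ.<? p ⟨$⟩ʳ lo k H x

¬inverted⇒< : (p : Permutation′ (2 + k)) (H : Subset n) → ∣ H ∣ ≡ k → x F.< y → ¬ Inverted p H x y →
  p ⟨$⟩ʳ lo k H x F.< p ⟨$⟩ʳ hi k H y
¬inverted⇒< {k} {x = x} {y} p H ∣H∣ x<y ¬inv with Fₚ.<-cmp (p ⟨$⟩ʳ lo k H x) (p ⟨$⟩ʳ hi k H y)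
... | tri< lt _ _ = lt
... | tri≈ _ eq _ = contradiction (⟨$⟩ʳ-injective p eq) (Fₚ.<⇒≢ (lo<hi H ∣H∣ (ℕₚ.<⇒≤ x<y)))
... | tri> _ _ gt = contradiction gt ¬inv

Determined : Permutation′ (2 + k) → Subset n → Vec (Maybe (Fin m)) n → Set
Determined p H π = ∀ {x y a b} → x F.< y → lookup π x ≡ just a → lookup π y ≡ just b →
  (a F.< b) ⇔ Inverted p H x y

entry : HolesAt H π → x ∉ H → ∃ λ a → lookup π x ≡ just a
entry {π = π} {x = x} holes x∉H with lookup π x in eq
... | just a = a , refl
... | nothing = contradiction (Equivalence.to (holes x) eq) x∉H

entry-∉ : ∀ {a} → HolesAt H π → lookup π x ≡ just a → x ∉ H
entry-∉ {x = x} holes πx x∈H with () ← trans (sym πx) (Equivalence.from (holes x) x∈H)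

-- If the entries at `x` and `y` were ordered like the pattern at the indices `lo` and `hi`,
-- `realize` would extend `π` to a permutation with an occurrence on `H` together with `x` and `y`.
avoids⇒determined : (p : Permutation′ (2 + k)) → ∣ H ∣ ≡ k → HolesAt H π → ExactlyOnce π →
  Avoids π p → Determined p H π
avoids⇒determined {k} {H = H} {π = π} p ∣H∣ holes once avoids {x} {y} {a} {b} x<y πx πy =
  go (Fₚ.<-cmp a b) (inverted? p H x y)
  where
  open Insertion (insertion {k = k} H ∣H∣ (entry-∉ {π = π} holes πx) (entry-∉ {π = π} holes πy) x<y)

  s≡lo : s ≡ lo k H x
  s≡lo = Fₚ.toℕ-injective (trans s≡ (sym (toℕ-lo H x ∣H∣)))

  t≡hi : t ≡ hi k H y
  t≡hi = Fₚ.toℕ-injective (trans t≡ (sym (toℕ-hi H y ∣H∣)))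

  πs : lookup π (c s) ≡ just a
  πs = trans (cong (lookup π) cs) πx

  πt : lookup π (c t) ≡ just b
  πt = trans (cong (lookup π) ct) πy

  hole : ∀ r → r ≢ s → r ≢ t → lookup π (c r) ≡ nothing
  hole r r≢s r≢t = Equivalence.from (holes (c r)) (others r r≢s r≢t)

  go : Tri (a F.< b) (a ≡ b) (b F.< a) → Dec (Inverted p H x y) →
    (a F.< b) ⇔ Inverted p H x y
  go (tri< a<b _ _) (yes inv) = mk⇔ (λ _ → inv) (λ _ → a<b)
  go (tri< a<b _ _) (no ¬inv) = contradiction avoids
    (realize π p c c-mono once s t a b πs πt a<b
      (subst₂ F._<_ (cong (p ⟨$⟩ʳ_) (sym s≡lo)) (cong (p ⟨$⟩ʳ_) (sym t≡hi)) (¬inverted⇒< p H ∣H∣ x<y ¬inv))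
      hole)
  go (tri≈ _ a≡b _) _ = contradiction (position-unique {π = π} once πx πy a≡b) (Fₚ.<⇒≢ x<y)
  go (tri> a≮b _ _) (no ¬inv) = mk⇔ (λ lt → contradiction lt a≮b) (λ inv → contradiction inv ¬inv)
  -- The smaller entry is now the one at `y`, so `realize` is applied with `s` and `t` exchanged.
  go (tri> _ _ b<a) (yes inv) = contradiction avoids
    (realize π p c c-mono once t s b a πt πs b<a
      (subst₂ F._<_ (cong (p ⟨$⟩ʳ_) (sym t≡hi)) (cong (p ⟨$⟩ʳ_) (sym s≡lo)) inv)
      (λ r r≢t r≢s → hole r r≢s r≢t))

-- By `two-crossings`, any occurrence contains two entries whose pattern indices are exactly `lo`
-- and `hi`. The occurrence orders them like the pattern, `Determined` the opposite way.
determined⇒avoids : (p : Permutation′ (2 + k)) → ∣ H ∣ ≡ k → HolesAt H π → Determined p H π → Avoids π p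
determined⇒avoids {k} {H = H} {π = π} p ∣H∣ holes det σ extends (c , c-mono , iso)
  with i , j , i<j , i∉ , j∉ , i≡ , j≡ ← two-crossings H ∣H∣ c c-mono
  with a , πi ← entry {π = π} holes i∉ | b , πj ← entry {π = π} holes j∉
  = go (inverted? p H (c i) (c j))
  where
  module E = Equivalence
  lo≡i : lo k H (c i) ≡ i
  lo≡i = Fₚ.toℕ-injective (trans (toℕ-lo H (c i) ∣H∣) (sym i≡))

  hi≡j : hi k H (c j) ≡ j
  hi≡j = Fₚ.toℕ-injective (trans (toℕ-hi H (c j) ∣H∣) (sym j≡))

  ci<cj : c i F.< c j
  ci<cj = c-mono i j i<j

  go : Dec (Inverted p H (c i) (c j)) → _
  go (yes inv) = Fₚ.<-asym
    (E.to (iso i j) (E.to (extends (c i) (c j) a b πi πj) (E.from (det ci<cj πi πj) inv)))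
    (subst₂ (λ r s → p ⟨$⟩ʳ r F.< p ⟨$⟩ʳ s) hi≡j lo≡i inv)
  go (no ¬inv) = ¬inv (E.to (det ci<cj πi πj) (E.from (extends (c i) (c j) a b πi πj) (E.from (iso i j)
    (subst₂ (λ r s → p ⟨$⟩ʳ r F.< p ⟨$⟩ʳ s) lo≡i hi≡j (¬inverted⇒< p H ∣H∣ ci<cj ¬inv)))))

strictMono⇒inflationary : (f : Fin m → Fin n) → (∀ i j → i F.< j → f i F.< f j) → ∀ i → i F.≤ f i
strictMono⇒inflationary {suc m} f mono = <-weakInduction (λ i → i F.≤ f i) z≤n λ i i≤ →
  ℕₚ.≤-trans (s≤s (subst (_≤ toℕ (f (inject₁ i))) (Fₚ.toℕ-inject₁ i) i≤))
    (mono (inject₁ i) (suc i) (s≤s (ℕₚ.≤-reflexive (Fₚ.toℕ-inject₁ i))))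

module _ (p : Permutation′ (2 + k)) {H : Subset n} {π π′ : Vec (Maybe (Fin m)) n}
         (once : ExactlyOnce π) (once′ : ExactlyOnce π′) (holes : HolesAt H π) (holes′ : HolesAt H π′)
         (det : Determined p H π) (det′ : Determined p H π′) where

  private
    transfer : ∀ {x y a b a′ b′} → lookup π x ≡ just a → lookup π y ≡ just b →
      lookup π′ x ≡ just a′ → lookup π′ y ≡ just b′ → a F.< b → a′ F.< b′
    transfer {x} {y} {a} {b} {a′} {b′} πx πy π′x π′y a<b with Fₚ.<-cmp x y
    ... | tri< x<y _ _ = Equivalence.from (det′ x<y π′x π′y) (Equivalence.to (det x<y πx πy) a<b)
    ... | tri≈ _ refl _ = contradiction (just-injective (trans (sym πx) πy)) (Fₚ.<⇒≢ a<b)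
    -- `Determined` speaks of increasing positions only; for `y < x` it is used to exclude the
    -- opposite comparison in `π′`.
    ... | tri> _ _ y<x with Fₚ.<-cmp a′ b′
    ...   | tri< a′<b′ _ _ = a′<b′
    ...   | tri≈ _ a′≡b′ _ = contradiction (position-unique {π = π′} once′ π′y π′x (sym a′≡b′)) (Fₚ.<⇒≢ y<x)
    ...   | tri> _ _ b′<a′ = contradiction
              (Equivalence.from (det y<x πy πx) (Equivalence.to (det′ y<x π′y π′x) b′<a′)) (Fₚ.<-asym a<b)

    entry′ : ∀ v → ∃ λ v′ → lookup π′ (proj₁ (once v)) ≡ just v′
    entry′ v = entry {π = π′} holes′ (entry-∉ {π = π} holes (proj₁ (proj₂ (once v))))

  -- Sending each value of `π` to the value of `π′` at the same position is strictly increasing, as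
  -- both have the same comparisons, and a strictly increasing self-map of `Fin m` lies above the
  -- identity. Exchanging `π` and `π′` then gives equality.
  determined-≤ : ∀ {x a b} → lookup π x ≡ just a → lookup π′ x ≡ just b → a F.≤ b
  determined-≤ {x} {a} {b} πx π′x = subst (a F.≤_) fa≡b (strictMono⇒inflationary (proj₁ ∘ entry′)
    (λ v w v<w → transfer (proj₁ (proj₂ (once v))) (proj₁ (proj₂ (once w)))
                   (proj₂ (entry′ v)) (proj₂ (entry′ w)) v<w) a)
    where
    fa≡b : proj₁ (entry′ a) ≡ b
    fa≡b = just-injective (trans (sym (proj₂ (entry′ a)))
      (trans (cong (lookup π′) (sym (proj₂ (proj₂ (once a)) x πx))) π′x))

lookup-ext : (∀ i → lookup π i ≡ lookup π′ i) → π ≡ π′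
lookup-ext {π = π} {π′} eq =
  trans (sym (tabulate∘lookup π)) (trans (tabulate-cong eq) (tabulate∘lookup π′))

determined-unique : (p : Permutation′ (2 + k)) → ExactlyOnce π → ExactlyOnce π′ →
  HolesAt H π → HolesAt H π′ → Determined p H π → Determined p H π′ → π ≡ π′
determined-unique {π = π} {π′} {H = H} p once once′ holes holes′ det det′ = lookup-ext pointwise
  where
  pointwise : ∀ i → lookup π i ≡ lookup π′ i
  pointwise i with i Sₚ.∈? H
  ... | yes i∈H = trans (Equivalence.from (holes i) i∈H) (sym (Equivalence.from (holes′ i) i∈H))
  ... | no i∉H with a , πi ← entry {π = π} holes i∉H | b , π′i ← entry {π = π′} holes′ i∉H =
    trans πi (trans (cong just (Fₚ.≤-antisym
      (determined-≤ p {π = π} {π′} once once′ holes holes′ det det′ πi π′i)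
      (determined-≤ p {π = π′} {π} once′ once holes′ holes det′ det π′i πi))) (sym π′i))

-- Excludes both 3-cycles on x < y < z in the tournament on the non-holes, in a form without negation.
Acyclic : Permutation′ (2 + k) → Subset n → Set
Acyclic {k} {n} p H = ∀ (x y z : Fin n) → x ∉ H → y ∉ H → z ∉ H → x F.< y → y F.< z →
  (Inverted p H x y → Inverted p H y z → Inverted p H x z) ×
  (Inverted p H x z → Inverted p H x y ⊎ Inverted p H y z)

acyclic? : (p : Permutation′ (2 + k)) (H : Subset n) → Dec (Acyclic p H)
acyclic? p H = Fₚ.all? λ x → Fₚ.all? λ y → Fₚ.all? λ z →
  ¬? (x Sₚ.∈? H) →-dec (¬? (y Sₚ.∈? H) →-dec (¬? (z Sₚ.∈? H) →-dec
  ((x Fₚ.<? y) →-dec ((y Fₚ.<? z) →-dec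
  ((inverted? p H x y →-dec (inverted? p H y z →-dec inverted? p H x z)) ×-dec
   (inverted? p H x z →-dec (inverted? p H x y ⊎-dec inverted? p H y z)))))))

-- `Determined` turns arcs into comparisons of entries, and `<` on entries is transitive and
-- cotransitive.
determined⇒acyclic : (p : Permutation′ (2 + k)) → HolesAt H π → Determined p H π → Acyclic p H
determined⇒acyclic {H = H} {π = π} p holes det x y z x∉ y∉ z∉ x<y y<z
  with a , πx ← entry {π = π} holes x∉ | b , πy ← entry {π = π} holes y∉ | c , πz ← entry {π = π} holes z∉
  = (λ txy tyz → to xz (Fₚ.<-trans (from xy txy) (from yz tyz))) , cotrans
  where
  open Equivalence
  xy = det x<y πx πy
  yz = det y<z πy πz
  xz = det (Fₚ.<-trans x<y y<z) πx πz

  cotrans : Inverted p H x z → Inverted p H x y ⊎ Inverted p H y z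
  cotrans txz with a Fₚ.<? b
  ... | yes a<b = inj₁ (to xy a<b)
  ... | no a≮b = inj₂ (to yz (ℕₚ.≤-<-trans (ℕₚ.≮⇒≥ a≮b) (from xz txz)))

module _ (p : Permutation′ (2 + k)) (H : Subset n) (∣∁H∣ : ∣ ∁ H ∣ ≡ m) (acyclic : Acyclic p H) where

  private
    e : Fin m → Fin n
    e = enum (∁ H) ∣∁H∣

    e∉ : ∀ i → e i ∉ H
    e∉ i = Sₚ.x∈∁p⇒x∉p (enum-∈ (∁ H) ∣∁H∣ i)

    e-mono : ∀ {i j} → i F.< j → e i F.< e j
    e-mono = enum-mono (∁ H) ∣∁H∣ _ _

    e-inj : ∀ {i j} → e i ≡ e j → i ≡ j
    e-inj = strictMono-injective (enum-mono (∁ H) ∣∁H∣)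

    Inv : Fin m → Fin m → Set
    Inv i j = Inverted p H (e i) (e j)

    Inv? : ∀ i j → Dec (Inv i j)
    Inv? i j = inverted? p H (e i) (e j)

    Inv-trans : ∀ {i j k} → i F.< j → j F.< k → Inv i j → Inv j k → Inv i k
    Inv-trans i<j j<k = proj₁ (acyclic _ _ _ (e∉ _) (e∉ _) (e∉ _) (e-mono i<j) (e-mono j<k))

    Inv-cotrans : ∀ {i j k} → i F.< j → j F.< k → Inv i k → Inv i j ⊎ Inv j k
    Inv-cotrans i<j j<k = proj₂ (acyclic _ _ _ (e∉ _) (e∉ _) (e∉ _) (e-mono i<j) (e-mono j<k))

    -- Meant as: non-hole number `i` receives a smaller value than non-hole number `j`. For `j < i`
    -- this is the failure of the arc recorded at the increasing pair.
    R : Fin m → Fin m → Set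
    R i j = (i F.< j × Inv i j) ⊎ (j F.< i × ¬ Inv j i)

    R? : ∀ i j → Dec (R i j)
    R? i j = ((i Fₚ.<? j) ×-dec Inv? i j) ⊎-dec ((j Fₚ.<? i) ×-dec ¬? (Inv? j i))

    R-irrefl : ∀ i → ¬ R i i
    R-irrefl i (inj₁ (i<i , _)) = Fₚ.<-irrefl refl i<i
    R-irrefl i (inj₂ (i<i , _)) = Fₚ.<-irrefl refl i<i

    -- Once `i`, `j`, `k` are sorted, every case is one of the two implications of `Acyclic`; for
    -- `i ≡ k` the two assumptions contradict each other.
    R-trans : ∀ i j k → R i j → R j k → R i k
    R-trans i j k (inj₁ (i<j , tij)) (inj₁ (j<k , tjk)) = inj₁ (Fₚ.<-trans i<j j<k , Inv-trans i<j j<k tij tjk)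
    R-trans i j k (inj₁ (i<j , tij)) (inj₂ (k<j , ¬tkj)) with Fₚ.<-cmp i k
    ... | tri< i<k _ _ = inj₁ (i<k , [ id , flip contradiction ¬tkj ]′ (Inv-cotrans i<k k<j tij))
    ... | tri≈ _ refl _ = contradiction tij ¬tkj
    ... | tri> _ _ k<i = inj₂ (k<i , λ tki → ¬tkj (Inv-trans k<i i<j tki tij))
    R-trans i j k (inj₂ (j<i , ¬tji)) (inj₁ (j<k , tjk)) with Fₚ.<-cmp i k
    ... | tri< i<k _ _ = inj₁ (i<k , [ flip contradiction ¬tji , id ]′ (Inv-cotrans j<i i<k tjk))
    ... | tri≈ _ refl _ = contradiction tjk ¬tji
    ... | tri> _ _ k<i = inj₂ (k<i , λ tki → ¬tji (Inv-trans j<k k<i tjk tki))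
    R-trans i j k (inj₂ (j<i , ¬tji)) (inj₂ (k<j , ¬tkj)) =
      inj₂ (Fₚ.<-trans k<j j<i , λ tki → [ ¬tkj , ¬tji ]′ (Inv-cotrans k<j j<i tki))

    R-connex : ∀ i j → i ≢ j → R i j ⊎ R j i
    R-connex i j i≢j with Fₚ.<-cmp i j
    ... | tri≈ _ i≡j _ = contradiction i≡j i≢j
    ... | tri< i<j _ _ with Inv? i j
    ...   | yes t = inj₁ (inj₁ (i<j , t))
    ...   | no ¬t = inj₂ (inj₂ (i<j , ¬t))
    R-connex i j i≢j | tri> _ _ j<i with Inv? j i
    ...   | yes t = inj₂ (inj₁ (j<i , t))
    ...   | no ¬t = inj₁ (inj₂ (j<i , ¬t))

    ranking = linearOrder⇒permutation R R? R-irrefl R-trans R-connex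

    σ : Permutation′ m
    σ = proj₁ ranking

    entryAt : Fin n → Maybe (Fin m)
    entryAt x with Fₚ.any? (λ i → e i Fₚ.≟ x)
    ... | yes (i , _) = just (σ ⟨$⟩ʳ i)
    ... | no _ = nothing

    entryAt-e : ∀ i → entryAt (e i) ≡ just (σ ⟨$⟩ʳ i)
    entryAt-e i with Fₚ.any? (λ j → e j Fₚ.≟ e i)
    ... | yes (j , eq) = cong (just ∘ (σ ⟨$⟩ʳ_)) (e-inj eq)
    ... | no miss = contradiction (i , refl) miss

    entryAt-just : ∀ {x v} → entryAt x ≡ just v → ∃ λ i → e i ≡ x × σ ⟨$⟩ʳ i ≡ v
    entryAt-just {x} eq with Fₚ.any? (λ i → e i Fₚ.≟ x)
    ... | yes (i , ei≡x) = i , ei≡x , just-injective eq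

    entryAt-hole : ∀ {x} → x ∈ H → entryAt x ≡ nothing
    entryAt-hole {x} x∈H with Fₚ.any? (λ i → e i Fₚ.≟ x)
    ... | yes (i , refl) = contradiction x∈H (e∉ i)
    ... | no _ = refl

    filled : Vec (Maybe (Fin m)) n
    filled = tabulate entryAt

    filled-at : ∀ x → lookup filled x ≡ entryAt x
    filled-at = lookup∘tabulate entryAt

    filled-once : ExactlyOnce filled
    filled-once v =
      e (σ ⟨$⟩ˡ v)
      , trans (filled-at _) (trans (entryAt-e _) (cong just (inverseʳ σ)))
      , unique
      where
      unique : ∀ x → lookup filled x ≡ just v → x ≡ e (σ ⟨$⟩ˡ v)
      unique x eq with i , refl , σi≡v ← entryAt-just (trans (sym (filled-at x)) eq) =
        cong e (⟨$⟩ʳ-injective σ (trans σi≡v (sym (inverseʳ σ))))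

    filled-holes : HolesAt H filled
    filled-holes x = mk⇔ hole (λ x∈H → trans (filled-at x) (entryAt-hole x∈H))
      where
      hole : lookup filled x ≡ nothing → x ∈ H
      hole eq with x Sₚ.∈? H
      ... | yes x∈H = x∈H
      ... | no x∉H with i , refl ← enum-surjective ∣∁H∣ (Sₚ.x∉p⇒x∈∁p x∉H)
                   with () ← trans (sym (entryAt-e i)) (trans (sym (filled-at (e i))) eq)

    filled-determined : Determined p H filled
    filled-determined {x} {y} x<y πx πy
      with i , refl , refl ← entryAt-just (trans (sym (filled-at x)) πx)
         | j , refl , refl ← entryAt-just (trans (sym (filled-at y)) πy)
      = mk⇔ to (λ t → proj₂ ranking i j (inj₁ (i<j , t)))
      where
      i<j : i F.< j
      i<j with Fₚ.<-cmp i j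
      ... | tri< lt _ _ = lt
      ... | tri≈ _ refl _ = contradiction x<y (Fₚ.<-irrefl refl)
      ... | tri> _ _ j<i = contradiction x<y (Fₚ.<-asym (e-mono j<i))

      to : σ ⟨$⟩ʳ i F.< σ ⟨$⟩ʳ j → Inv i j
      to lt with Inv? i j
      ... | yes t = t
      ... | no ¬t = contradiction lt (Fₚ.<-asym (proj₂ ranking j i (inj₂ (i<j , ¬t))))

  -- Without 3-cycles the tournament is a linear order. Its ranks are the values, written into the
  -- non-holes.
  acyclic⇒determined : ∃ λ (π : Vec (Maybe (Fin m)) n) → ExactlyOnce π × HolesAt H π × Determined p H π
  acyclic⇒determined = filled , filled-once , filled-holes , filled-determined

-- Baxter permutations and acyclic tournaments

-- As `y` has distinct entries, trichotomy yields the converse. The Boolean comparison computes on a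
-- concrete pattern, so index pairs that do not ascend are absurd.
orderIso : (x y : Vec ℕ m) → (∀ i j → T (lookup y i ℕ.<ᵇ lookup y j) → lookup x i < lookup x j) →
  (∀ i j → lookup y i ≡ lookup y j → i ≡ j) → OrderIso x y
orderIso x y mono inj i j = mk⇔ reflect (λ lt → mono i j (ℕₚ.<⇒<ᵇ lt))
  where
  reflect : lookup x i < lookup x j → lookup y i < lookup y j
  reflect lt with ℕₚ.<-cmp (lookup y i) (lookup y j)
  ... | tri< y<y _ _ = y<y
  ... | tri≈ _ eq _ = contradiction lt (ℕₚ.<-irrefl (cong (lookup x) (inj i j eq)))
  ... | tri> _ _ y>y = contradiction lt (ℕₚ.<-asym (mono j i (ℕₚ.<⇒<ᵇ y>y)))

distinct? : (y : Vec ℕ m) → Dec (∀ i j → lookup y i ≡ lookup y j → i ≡ j)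
distinct? y = Fₚ.all? λ i → Fₚ.all? λ j → (lookup y i ℕ.≟ lookup y j) →-dec (i Fₚ.≟ j)

orderIso-2413 : ∀ {a b c d} → c < a → a < d → d < b → OrderIso (a ∷ b ∷ c ∷ d ∷ []) (2 ∷ 4 ∷ 1 ∷ 3 ∷ [])
orderIso-2413 {a} {b} {c} {d} c<a a<d d<b = orderIso w (2 ∷ 4 ∷ 1 ∷ 3 ∷ []) mono (from-yes (distinct? (2 ∷ 4 ∷ 1 ∷ 3 ∷ [])))
  where
  w : Vec ℕ 4
  w = a ∷ b ∷ c ∷ d ∷ []
  mono : ∀ i j → T (lookup (2 ∷ 4 ∷ 1 ∷ 3 ∷ []) i ℕ.<ᵇ lookup (2 ∷ 4 ∷ 1 ∷ 3 ∷ []) j) → lookup w i < lookup w j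
  mono 2F 0F _ = c<a
  mono 2F 3F _ = ℕₚ.<-trans c<a a<d
  mono 2F 1F _ = ℕₚ.<-trans c<a (ℕₚ.<-trans a<d d<b)
  mono 0F 3F _ = a<d
  mono 0F 1F _ = ℕₚ.<-trans a<d d<b
  mono 3F 1F _ = d<b
  mono 3F 0F ()
  mono 1F 2F ()
  mono 1F 3F ()
  mono 2F 2F ()
  mono 3F 2F ()
  mono 3F 3F ()

orderIso-3142 : ∀ {a b c d} → b < d → d < a → a < c → OrderIso (a ∷ b ∷ c ∷ d ∷ []) (3 ∷ 1 ∷ 4 ∷ 2 ∷ [])
orderIso-3142 {a} {b} {c} {d} b<d d<a a<c = orderIso w (3 ∷ 1 ∷ 4 ∷ 2 ∷ []) mono (from-yes (distinct? (3 ∷ 1 ∷ 4 ∷ 2 ∷ [])))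
  where
  w : Vec ℕ 4
  w = a ∷ b ∷ c ∷ d ∷ []
  mono : ∀ i j → T (lookup (3 ∷ 1 ∷ 4 ∷ 2 ∷ []) i ℕ.<ᵇ lookup (3 ∷ 1 ∷ 4 ∷ 2 ∷ []) j) → lookup w i < lookup w j
  mono 1F 3F _ = b<d
  mono 1F 0F _ = ℕₚ.<-trans b<d d<a
  mono 1F 2F _ = ℕₚ.<-trans b<d (ℕₚ.<-trans d<a a<c)
  mono 3F 0F _ = d<a
  mono 3F 2F _ = ℕₚ.<-trans d<a a<c
  mono 0F 2F _ = a<c
  mono 0F 3F ()
  mono 2F 1F ()
  mono 3F 1F ()
  mono 2F 3F ()
  mono 3F 3F ()

-- With `a`, `b`, `c`, `d` the values of `p` at `lo x`, `lo y`, `hi y`, `hi z`, the three arcs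
-- compare `c` with `a`, `d` with `b` and `d` with `a`. One 3-cycle makes these values a 2413, the
-- other a 3142, and the two middle indices are adjacent.
baxter⇒acyclic : (p : Permutation′ (2 + k)) → IsBaxter p → ∣ H ∣ ≡ k → Acyclic p H
baxter⇒acyclic {k} {H = H} p baxter ∣H∣ x y z _ _ _ x<y y<z = no2413 , no3142
  where
  lo-mono : lo k H x F.≤ lo k H y
  lo-mono = subst₂ _≤_ (sym (toℕ-lo H x ∣H∣)) (sym (toℕ-lo H y ∣H∣)) (below-mono H (ℕₚ.<⇒≤ x<y))

  hi-mono : hi k H y F.≤ hi k H z
  hi-mono = subst₂ _≤_ (sym (toℕ-hi H y ∣H∣)) (sym (toℕ-hi H z ∣H∣)) (s≤s (below-mono H (ℕₚ.<⇒≤ y<z)))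

  adjacent : toℕ (hi k H y) ≡ suc (toℕ (lo k H y))
  adjacent = trans (toℕ-hi H y ∣H∣) (cong suc (sym (toℕ-lo H y ∣H∣)))

  -- Both arguments are mere disequalities of indices, obtained from distinct values of `p`; the
  -- weak monotonicity of `lo` and `hi` makes them strict inequalities.
  excluded = λ a<b c<d → baxter (lo k H x) (lo k H y) (hi k H y) (hi k H z)
    (Fₚ.≤∧≢⇒< lo-mono a<b) (lo<hi {x = y} {y = y} H ∣H∣ ℕₚ.≤-refl) (Fₚ.≤∧≢⇒< hi-mono c<d) adjacent

  distinct : ∀ {i j} → p ⟨$⟩ʳ i F.< p ⟨$⟩ʳ j → i ≢ j
  distinct lt refl = Fₚ.<-irrefl refl lt

  no2413 : Inverted p H x y → Inverted p H y z → Inverted p H x z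
  no2413 c<a d<b with inverted? p H x z
  ... | yes d<a = d<a
  ... | no d≮a = contradiction (orderIso-2413 c<a a<d d<b)
          (proj₁ (excluded (distinct (Fₚ.<-trans a<d d<b)) (distinct (Fₚ.<-trans c<a a<d))))
    where a<d = ¬inverted⇒< p H ∣H∣ (Fₚ.<-trans x<y y<z) d≮a

  no3142 : Inverted p H x z → Inverted p H x y ⊎ Inverted p H y z
  no3142 d<a with inverted? p H x y | inverted? p H y z
  ... | yes c<a | _ = inj₁ c<a
  ... | no _ | yes d<b = inj₂ d<b
  ... | no c≮a | no d≮b = contradiction (orderIso-3142 b<d d<a a<c)
          (proj₂ (excluded (distinct (Fₚ.<-trans b<d d<a) ∘ sym) (distinct (Fₚ.<-trans d<a a<c) ∘ sym)))
    where
    a<c = ¬inverted⇒< p H ∣H∣ x<y c≮a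
    b<d = ¬inverted⇒< p H ∣H∣ y<z d≮b

subset-of-size : k ≤ n → Σ (Subset n) λ H → ∣ H ∣ ≡ k
subset-of-size {zero} {n} _ = ⊥ , Sₚ.∣⊥∣≡0 n
subset-of-size {suc k} {suc n} (s≤s k≤n) with H , refl ← subset-of-size k≤n = inside ∷ H , refl

-- Greedy construction from the left: if the next non-hole asks for no further hole before it, it is
-- placed; otherwise a hole is placed and all demands drop by one. Holes left over at the end go
-- anywhere.
prescribed-gaps : ∀ {n j k} (g : Fin j → ℕ) → (∀ {a b} → a F.≤ b → g a ≤ g b) → (∀ a → g a ≤ k) → k + j ≤ n →
  Σ (Subset n) λ H → Σ (Fin j → Fin n) λ f → ∣ H ∣ ≡ k × (∀ {a b} → a F.< b → f a F.< f b) ×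
    (∀ a → f a ∉ H) × (∀ a → below H (toℕ (f a)) ≡ g a)
prescribed-gaps {j = zero} {k} g g-mono g≤k k≤n
  with H , ∣H∣ ← subset-of-size (subst (_≤ _) (ℕₚ.+-identityʳ k) k≤n) =
  H , (λ ()) , ∣H∣ , (λ {}) , (λ ()) , λ ()
prescribed-gaps {zero} {suc j} {k} g _ _ k+j≤n with () ← subst (_≤ 0) (ℕₚ.+-suc k j) k+j≤n
prescribed-gaps {suc n} {suc j} {k} g g-mono g≤k k+j≤n with g zero in g₀
... | zero
  with H , f , ∣H∣ , f-mono , f∉ , gap ← prescribed-gaps {n} (g ∘ suc) (λ a≤b → g-mono (s≤s a≤b)) (g≤k ∘ suc)
         (ℕ.s≤s⁻¹ (subst (_≤ suc n) (ℕₚ.+-suc k j) k+j≤n)) =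
  outside ∷ H , (λ { zero → zero ; (suc a) → suc (f a) }) , ∣H∣
  , (λ { {zero} {suc b} _ → s≤s z≤n ; {suc a} {suc b} (s≤s a<b) → s≤s (f-mono a<b) })
  , (λ { (suc a) (there fa∈) → f∉ a fa∈ })
  , (λ { zero → sym g₀ ; (suc a) → gap a })
prescribed-gaps {suc n} {suc j} {zero} g g-mono g≤k k+j≤n | suc _ with () ← subst (_≤ 0) g₀ (g≤k zero)
prescribed-gaps {suc n} {suc j} {suc k} g g-mono g≤k (s≤s k+j≤n) | suc _
  with H , f , ∣H∣ , f-mono , f∉ , gap ← prescribed-gaps {n} (ℕ.pred ∘ g) (ℕₚ.pred-mono-≤ ∘ g-mono)
         (ℕₚ.pred-mono-≤ ∘ g≤k) k+j≤n =
  inside ∷ H , suc ∘ f , cong suc ∣H∣ , (λ a<b → s≤s (f-mono a<b))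
  , (λ { a (there fa∈) → f∉ a fa∈ })
  -- Every `g a` is at least the positive `g zero`, so `pred` takes off exactly the hole just
  -- placed.
  , λ a → trans (cong suc (gap a)) (ℕₚ.suc-pred (g a) {{ℕ.>-nonZero (ℕₚ.<-≤-trans (subst (0 <_) (sym g₀) (s≤s z≤n)) (g-mono z≤n))}})

-- An occurrence of 2413 or 3142 with adjacent middle positions is turned into a hole set in which
-- three non-holes have these positions as their pattern indices, so that they form a 3-cycle.
acyclic⇒baxter : (p : Permutation′ (2 + k)) → k + 3 ≤ n →
  (∀ {H : Subset n} → ∣ H ∣ ≡ k → Acyclic p H) → IsBaxter p
acyclic⇒baxter {k} p k+3≤n acyclic a b c (suc d) a<b b<c c<d c≡1+b = no2413 , no3142
  where
  b≤d : b F.≤ d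
  b≤d = ℕ.s≤s⁻¹ (ℕₚ.≤-trans (s≤s (ℕₚ.<⇒≤ b<c)) c<d)

  -- The fourth index `suc d` is read as a `hi`, one more than the number of holes before the last
  -- non-hole; hence the gap `d`. The middle non-hole supplies both `b` and `c`.
  gaps : Fin 3 → ℕ
  gaps = λ { 0F → toℕ a ; 1F → toℕ b ; 2F → toℕ d }

  gaps-mono : ∀ {i j} → i F.≤ j → gaps i ≤ gaps j
  gaps-mono {0F} {0F} _ = ℕₚ.≤-refl
  gaps-mono {0F} {1F} _ = ℕₚ.<⇒≤ a<b
  gaps-mono {0F} {2F} _ = ℕₚ.≤-trans (ℕₚ.<⇒≤ a<b) b≤d
  gaps-mono {1F} {1F} _ = ℕₚ.≤-refl
  gaps-mono {1F} {2F} _ = b≤d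
  gaps-mono {2F} {2F} _ = ℕₚ.≤-refl
  gaps-mono {1F} {0F} ()
  gaps-mono {2F} {0F} ()
  gaps-mono {2F} {1F} (s≤s ())

  gaps-≤ : ∀ i → gaps i ≤ k
  gaps-≤ i = ℕₚ.≤-trans (gaps-mono {i} {2F} (Fₚ.toℕ≤pred[n] i)) (Fₚ.toℕ≤pred[n] d)

  spread = prescribed-gaps gaps gaps-mono gaps-≤ k+3≤n
  S = proj₁ spread
  f = proj₁ (proj₂ spread)
  ∣S∣ = proj₁ (proj₂ (proj₂ spread))
  f-mono = proj₁ (proj₂ (proj₂ (proj₂ spread)))
  f∉ = proj₁ (proj₂ (proj₂ (proj₂ (proj₂ spread))))
  gap = proj₂ (proj₂ (proj₂ (proj₂ (proj₂ spread))))

  lo≡ : ∀ i {r} → gaps i ≡ toℕ r → lo k S (f i) ≡ r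
  lo≡ i eq = Fₚ.toℕ-injective (trans (toℕ-lo S (f i) ∣S∣) (trans (gap i) eq))

  hi≡ : ∀ i {r} → suc (gaps i) ≡ toℕ r → hi k S (f i) ≡ r
  hi≡ i eq = Fₚ.toℕ-injective (trans (toℕ-hi S (f i) ∣S∣) (trans (cong suc (gap i)) eq))

  triple : (Inverted p S (f 0F) (f 1F) → Inverted p S (f 1F) (f 2F) → Inverted p S (f 0F) (f 2F)) ×
           (Inverted p S (f 0F) (f 2F) → Inverted p S (f 0F) (f 1F) ⊎ Inverted p S (f 1F) (f 2F))
  triple = acyclic ∣S∣ (f 0F) (f 1F) (f 2F) (f∉ 0F) (f∉ 1F) (f∉ 2F) (f-mono (s≤s z≤n)) (f-mono (s≤s (s≤s z≤n)))

  P : Fin (2 + k) → ℕ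
  P r = toℕ (p ⟨$⟩ʳ r)

  triple′ : (P c < P a → P (suc d) < P b → P (suc d) < P a) × (P (suc d) < P a → P c < P a ⊎ P (suc d) < P b)
  triple′ = subst (λ (a , b , c , d) → (P c < P a → P d < P b → P d < P a) × (P d < P a → P c < P a ⊎ P d < P b))
    (cong₂ _,_ (lo≡ 0F refl) (cong₂ _,_ (lo≡ 1F refl) (cong₂ _,_ (hi≡ 1F (sym c≡1+b)) (hi≡ 2F refl)))) triple

  no2413 : ¬ OrderIso (P a ∷ P b ∷ P c ∷ P (suc d) ∷ []) (2 ∷ 4 ∷ 1 ∷ 3 ∷ [])
  no2413 iso = ℕₚ.<-asym (Equivalence.from (iso 0F 3F) (ℕₚ.<ᵇ⇒< 2 3 _))
    (proj₁ triple′ (Equivalence.from (iso 2F 0F) (ℕₚ.<ᵇ⇒< 1 2 _)) (Equivalence.from (iso 3F 1F) (ℕₚ.<ᵇ⇒< 3 4 _)))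

  no3142 : ¬ OrderIso (P a ∷ P b ∷ P c ∷ P (suc d) ∷ []) (3 ∷ 1 ∷ 4 ∷ 2 ∷ [])
  no3142 iso with proj₂ triple′ (Equivalence.from (iso 3F 0F) (ℕₚ.<ᵇ⇒< 2 3 _))
  ... | inj₁ c<a = ℕₚ.<-asym c<a (Equivalence.from (iso 0F 2F) (ℕₚ.<ᵇ⇒< 3 4 _))
  ... | inj₂ d<b = ℕₚ.<-asym d<b (Equivalence.from (iso 1F 3F) (ℕₚ.<ᵇ⇒< 1 2 _))

-- Enumeration of hole sets

subsets : ∀ n → ℕ → List (Subset n)
subsets zero zero = [] List.∷ List.[]
subsets zero (suc k) = List.[]
subsets (suc n) zero = List.map (outside ∷_) (subsets n zero)
subsets (suc n) (suc k) = List.map (inside ∷_) (subsets n k) ++ List.map (outside ∷_) (subsets n (suc k))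

∈-subsets⁺ : (H : Subset n) → ∣ H ∣ ≡ k → H ∈ₗ subsets n k
∈-subsets⁺ [] refl = here refl
∈-subsets⁺ {k = zero} (outside ∷ H) eq = ∈-map⁺ (outside ∷_) (∈-subsets⁺ H eq)
∈-subsets⁺ {k = suc k} (inside ∷ H) refl = ∈-++⁺ˡ (∈-map⁺ (inside ∷_) (∈-subsets⁺ H refl))
∈-subsets⁺ {suc n} {k = suc k} (outside ∷ H) eq =
  ∈-++⁺ʳ (List.map (inside ∷_) (subsets n k)) (∈-map⁺ (outside ∷_) (∈-subsets⁺ H eq))

∈-subsets⁻ : ∀ n k {H : Subset n} → H ∈ₗ subsets n k → ∣ H ∣ ≡ k
∈-subsets⁻ zero zero (here refl) = refl
∈-subsets⁻ (suc n) zero H∈ with _ , H′∈ , refl ← ∈-map⁻ (outside ∷_) H∈ = ∈-subsets⁻ n zero H′∈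
∈-subsets⁻ (suc n) (suc k) H∈ with ∈-++⁻ (List.map (inside ∷_) (subsets n k)) H∈
... | inj₁ H∈ˡ with _ , H′∈ , refl ← ∈-map⁻ (inside ∷_) H∈ˡ = cong suc (∈-subsets⁻ n k H′∈)
... | inj₂ H∈ʳ with _ , H′∈ , refl ← ∈-map⁻ (outside ∷_) H∈ʳ = ∈-subsets⁻ n (suc k) H′∈

subsets-unique : ∀ n k → Unique (subsets n k)
subsets-unique zero zero = All.[] ∷ []
subsets-unique zero (suc k) = []
subsets-unique (suc n) zero = Uniqueₚ.map⁺ ∷-injectiveʳ (subsets-unique n zero)
subsets-unique (suc n) (suc k) = Uniqueₚ.++⁺
  (Uniqueₚ.map⁺ ∷-injectiveʳ (subsets-unique n k))
  (Uniqueₚ.map⁺ ∷-injectiveʳ (subsets-unique n (suc k)))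
  disjoint
  where
  disjoint : ∀ {H} → ¬ (H ∈ₗ List.map (inside ∷_) (subsets n k) × H ∈ₗ List.map (outside ∷_) (subsets n (suc k)))
  disjoint (H∈ˡ , H∈ʳ) with _ , _ , refl ← ∈-map⁻ (inside ∷_) H∈ˡ with _ , _ , () ← ∈-map⁻ (outside ∷_) H∈ʳ

length-subsets : ∀ n k → length (subsets n k) ≡ n C k
length-subsets zero zero = refl
length-subsets zero (suc k) = refl
length-subsets (suc n) zero = begin
  length (List.map (outside ∷_) (subsets n zero))  ≡⟨ Listₚ.length-map (outside ∷_) (subsets n zero) ⟩
  length (subsets n zero)                          ≡⟨ length-subsets n zero ⟩
  n C 0                                            ≡⟨ trans (nCk≡nC[n∸k] {n = n} z≤n) (nCn≡1 n) ⟩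
  1                                                ≡⟨ trans (nCk≡nC[n∸k] {n = suc n} z≤n) (nCn≡1 (suc n)) ⟨
  suc n C 0                                        ∎
  where open ≡-Reasoning
length-subsets (suc n) (suc k) = begin
  length (List.map (inside ∷_) (subsets n k) ++ List.map (outside ∷_) (subsets n (suc k)))
    ≡⟨ Listₚ.length-++ (List.map (inside ∷_) (subsets n k)) ⟩
  length (List.map (inside ∷_) (subsets n k)) + length (List.map (outside ∷_) (subsets n (suc k)))
    ≡⟨ cong₂ _+_ (trans (Listₚ.length-map (inside ∷_) (subsets n k)) (length-subsets n k))
                 (trans (Listₚ.length-map (outside ∷_) (subsets n (suc k))) (length-subsets n (suc k))) ⟩
  n C k + n C suc k
    ≡⟨ nCk+nC[k+1]≡[n+1]C[k+1] n k ⟩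
  suc n C suc k ∎
  where open ≡-Reasoning

-- Counting avoiders by their hole sets

lookup-injective : ∀ {A : Set} {xs : List A} → Unique xs → ∀ i j → List.lookup xs i ≡ List.lookup xs j → i ≡ j
lookup-injective (_ ∷ _) zero zero _ = refl
lookup-injective (x≢ ∷ _) zero (suc j) eq = contradiction eq (All.lookup x≢ (∈-lookup j))
lookup-injective (x≢ ∷ _) (suc i) zero eq = contradiction (sym eq) (All.lookup x≢ (∈-lookup i))
lookup-injective (_ ∷ xs!) (suc i) (suc j) eq = cong suc (lookup-injective xs! i j eq)

holesAt-unique : ∀ {H H′ : Subset n} (π : Vec (Maybe (Fin m)) n) → HolesAt H π → HolesAt H′ π → H ≡ H′
holesAt-unique π holes holes′ = Sₚ.⊆-antisym
  (λ {x} x∈ → Equivalence.to (holes′ x) (Equivalence.from (holes x) x∈))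
  (λ {x} x∈ → Equivalence.to (holes x) (Equivalence.from (holes′ x) x∈))

holesOf : Vec (Maybe (Fin m)) n → Subset n
holesOf = map is-nothing

holesOf-correct : (π : Vec (Maybe (Fin m)) n) → HolesAt (holesOf π) π
holesOf-correct π x = mk⇔
  (λ eq → lookup⇒[]= x (holesOf π) (trans (lookup-map x is-nothing π) (cong is-nothing eq)))
  λ x∈ → is-nothing⁻ (trans (sym (lookup-map x is-nothing π)) ([]=⇒lookup x∈))
  where
  is-nothing⁻ : ∀ {a : Maybe (Fin _)} → is-nothing a ≡ inside → a ≡ nothing
  is-nothing⁻ {nothing} _ = refl

-- Taking the hole set is a bijection from `Q` to the list: `fill` makes it surjective, `unique`
-- injective. As a vector has only one hole set, distinct list positions get distinct fillings.
hasCard-by-holes : (Q : Vec (Maybe (Fin m)) n → Set) {Hs : List (Subset n)} → Unique Hs →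
  (∀ {H} → H ∈ₗ Hs → ∃ λ π → Q π × HolesAt H π) →
  (∀ {π} → Q π → ∃ λ H → H ∈ₗ Hs × HolesAt H π) →
  (∀ {H π π′} → Q π → Q π′ → HolesAt H π → HolesAt H π′ → π ≡ π′) →
  HasCard Q (length Hs)
hasCard-by-holes {m} {n} Q {Hs} Hs! fill holes unique =
  (λ i → proj₁ (filling i)) , (λ i → proj₁ (proj₂ (filling i))) , injective , surjective
  where
  filling : ∀ i → ∃ λ π → Q π × HolesAt (List.lookup Hs i) π
  filling i = fill (∈-lookup i)

  injective : ∀ i j → proj₁ (filling i) ≡ proj₁ (filling j) → i ≡ j
  injective i j eq = lookup-injective Hs! i j (holesAt-unique (proj₁ (filling i)) (proj₂ (proj₂ (filling i)))
    (subst (HolesAt (List.lookup Hs j)) (sym eq) (proj₂ (proj₂ (filling j)))))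

  surjective : ∀ π → Q π → ∃ λ i → proj₁ (filling i) ≡ π
  surjective π qπ with H , H∈ , holesH ← holes qπ =
    Any.index H∈ , unique (proj₁ (proj₂ (filling (Any.index H∈)))) qπ (proj₂ (proj₂ (filling (Any.index H∈))))
      (subst (λ H → HolesAt H π) (lookup-index H∈) holesH)

-- Non-hole positions inject into values by reading the entry, and values into non-hole positions by
-- locating it. So the complement of `H` has `n ∸ k` elements, and `k ≤ n` allows cancelling.
∣holes∣ : IsPartialPerm n k π → HolesAt H π → ∣ H ∣ ≡ k
∣holes∣ {n} {k} {π} {H} (k≤n , once) holes = ℕₚ.∸-cancelˡ-≡ (Sₚ.∣p∣≤n H) k≤n
  (trans (sym (Sₚ.∣∁p∣≡n∸∣p∣ H)) (Fₚ.cantor-schröder-bernstein valueAt-injective indexOf-injective))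
  where
  e : Fin ∣ ∁ H ∣ → Fin n
  e = enum (∁ H) refl

  value : ∀ i → ∃ λ v → lookup π (e i) ≡ just v
  value i = entry {π = π} holes (Sₚ.x∈∁p⇒x∉p (enum-∈ (∁ H) refl i))

  valueAt-injective : ∀ {i j} → proj₁ (value i) ≡ proj₁ (value j) → i ≡ j
  valueAt-injective {i} {j} eq = strictMono-injective (enum-mono (∁ H) refl)
    (position-unique {π = π} once (proj₂ (value i)) (proj₂ (value j)) eq)

  index : ∀ v → ∃ λ i → e i ≡ proj₁ (once v)
  index v = enum-surjective refl (Sₚ.x∉p⇒x∈∁p (entry-∉ {π = π} holes (proj₁ (proj₂ (once v)))))

  indexOf-injective : ∀ {v w} → proj₁ (index v) ≡ proj₁ (index w) → v ≡ w
  indexOf-injective {v} {w} eq = just-injective (trans (sym (proj₁ (proj₂ (once v))))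
    (trans (cong (lookup π) (trans (sym (proj₂ (index v))) (trans (cong e eq) (proj₂ (index w)))))
      (proj₁ (proj₂ (once w)))))

Avoider : Permutation′ (2 + k) → Vec (Maybe (Fin (n ∸ k))) n → Set
Avoider {k} {n} p π = IsPartialPerm n k π × Avoids π p

avoider-determined : (p : Permutation′ (2 + k)) → Avoider p π → HolesAt H π → Determined p H π
avoider-determined {π = π} p (pp , avoids) holes =
  avoids⇒determined {π = π} p (∣holes∣ {π = π} pp holes) holes (proj₂ pp) avoids

avoider-unique : (p : Permutation′ (2 + k)) → Avoider p π → Avoider p π′ → HolesAt H π → HolesAt H π′ → π ≡ π′
avoider-unique {π = π} {π′} p av av′ holes holes′ = determined-unique {π = π} {π′} p
  (proj₂ (proj₁ av)) (proj₂ (proj₁ av′)) holes holes′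
  (avoider-determined {π = π} p av holes) (avoider-determined {π = π′} p av′ holes′)

acyclic⇒avoider : (p : Permutation′ (2 + k)) → ∣ H ∣ ≡ k → Acyclic p H → ∃ λ π → Avoider p π × HolesAt H π
acyclic⇒avoider {H = H} p refl acyclic = map₂
  (λ {π} (once , holes , det) → ((Sₚ.∣p∣≤n H , once) , determined⇒avoids {π = π} p refl holes det) , holes)
  (acyclic⇒determined p H (Sₚ.∣∁p∣≡n∸∣p∣ H) acyclic)

-- The hole sets of avoiders are exactly the acyclic ones, and each carries a single avoider. All
-- three claims on Baxter patterns thus become questions about acyclicity.
avoider-count : (p : Permutation′ (2 + k)) → s[ n , k ]≡ p (length (filter (acyclic? p) (subsets n k)))
avoider-count {k} {n} p = hasCard-by-holes (Avoider p) (Uniqueₚ.filter⁺ (acyclic? p) (subsets-unique n k))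
  fill (λ {π} → holes {π}) (λ {_} {π} {π′} → avoider-unique {π = π} {π′} p)
  where
  fill : ∀ {H} → H ∈ₗ filter (acyclic? p) (subsets n k) → ∃ λ π → Avoider p π × HolesAt H π
  fill H∈ with H∈′ , acyclic ← ∈-filter⁻ (acyclic? p) H∈ = acyclic⇒avoider p (∈-subsets⁻ n k H∈′) acyclic

  holes : ∀ {π} → Avoider p π → ∃ λ H → H ∈ₗ filter (acyclic? p) (subsets n k) × HolesAt H π
  holes {π} av = holesOf π
    , ∈-filter⁺ (acyclic? p) (∈-subsets⁺ (holesOf π) (∣holes∣ {π = π} (proj₁ av) (holesOf-correct π)))
        (determined⇒acyclic {π = π} p (holesOf-correct π) (avoider-determined {π = π} p av (holesOf-correct π)))
    , holesOf-correct π

hasCard-1 : {A : Set} {Q : A → Set} → ∃ Q → (∀ {x y} → Q x → Q y → x ≡ y) → HasCard Q 1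
hasCard-1 (x , qx) unique = (λ _ → x) , (λ _ → qx) , (λ { 0F 0F _ → refl }) , λ y qy → 0F , unique qx qy

baxter-count-at : (p : Permutation′ (2 + k)) → IsBaxter p → ∣ H ∣ ≡ k → sH[ n , k , H ]≡ p 1
baxter-count-at p baxter ∣H∣ = hasCard-1
  (map₂ (λ ((pp , avoids) , holes) → pp , holes , avoids)
    (acyclic⇒avoider p ∣H∣ (baxter⇒acyclic p baxter ∣H∣)))
  λ {π} {π′} (pp , holes , avoids) (pp′ , holes′ , avoids′) →
    avoider-unique {π = π} {π′} p (pp , avoids) (pp′ , avoids′) holes holes′

theorem26 : ∀ (ℓ : ℕ) → 2 ≤ ℓ → (p : Permutation′ ℓ) →
    (IsBaxter p → ∀ (n : ℕ) → ℓ ∸ 2 ≤ n → s[ n , ℓ ∸ 2 ]≡ p (n C (ℓ ∸ 2)))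
    × (¬ IsBaxter p → ∀ (n : ℕ) → ℓ ∸ 2 + 3 ≤ n →
    ∃ λ m → m < n C (ℓ ∸ 2) × s[ n , ℓ ∸ 2 ]≡ p m)
    × (∀ (q : Permutation′ ℓ) → IsBaxter p → IsBaxter q → StronglyWilfEquiv (ℓ ∸ 2) p q)
theorem26 (suc (suc k)) (s≤s (s≤s z≤n)) p = baxter-count , nonBaxter-count
  -- The common count is 1: for a Baxter pattern every hole set of size `k` is acyclic.
  , λ q p-baxter q-baxter n H ∣H∣ → 1 , baxter-count-at p p-baxter ∣H∣ , baxter-count-at q q-baxter ∣H∣
  where
  baxter-count : IsBaxter p → ∀ n → k ≤ n → s[ n , k ]≡ p (n C k)
  baxter-count baxter n _ = subst (s[ n , k ]≡ p)
    (trans (cong length (Listₚ.filter-all (acyclic? p) (All.tabulate (baxter⇒acyclic p baxter ∘ ∈-subsets⁻ n k))))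
      (length-subsets n k))
    (avoider-count p)

  nonBaxter-count : ¬ IsBaxter p → ∀ n → k + 3 ≤ n → ∃ λ m → m < n C k × s[ n , k ]≡ p m
  nonBaxter-count ¬baxter n k+3≤n = _
    , subst (length (filter (acyclic? p) (subsets n k)) <_) (length-subsets n k)
        -- If all hole sets were acyclic, `p` would be Baxter; decidability turns this into a hole
        -- set that the filter drops.
        (Listₚ.filter-notAll (acyclic? p) (subsets n k) (¬All⇒Any¬ (acyclic? p) (subsets n k) ¬allAcyclic))
    , avoider-count p
    where
    ¬allAcyclic : ¬ All (Acyclic p) (subsets n k)
    ¬allAcyclic all = ¬baxter (acyclic⇒baxter p k+3≤n λ {H} ∣H∣ → All.lookup all (∈-subsets⁺ H ∣H∣))
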